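{- For all positive integers $n,r$, \[C_r(q)+q\sum_{k=1}^{r-1}C_{r-k}(q)\sum_{m=0}^{k-1}(q-1)^m\binom{k-1}{m}\binom{n-2r+2k-m}{k}=\sum_{m=0}^{r-1}(q-1)^m\binom{r-1}{m}\binom{n-m}{r-1}.\]
   Context: $q$ is an indeterminate. The Narayana polynomials are $C_0(q)=1$ and $C_n(q)=\sum_{k=1}^n \frac1n\binom{n}{k-1}\binom{n}{k}q^{k-1}$ for $n\ge1$. Binomial coefficients $\binom{x}{k}$ with integer $k\ge0$ and arbitrary (possibly negative) integer $x$ mean $x(x-1)\cdots(x-k+1)/k!$. -}

module Defs where

open import Data.Nat as ℕ using (ℕ; zero; suc)
open import Data.Nat using (_!)
open import Data.Nat.Properties using (_!≢0)
open import Data.Integer as ℤ using (ℤ; +_)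
open import Data.Rational as ℚ using (ℚ; 0ℚ; 1ℚ)
open import Data.List using (List; []; _∷_)
open import Relation.Binary.PropositionalEquality using (_≡_)

fallingℤ : ℤ → ℕ → ℤ
fallingℤ x zero    = + 1
fallingℤ x (suc k) = fallingℤ x k ℤ.* (x ℤ.- + k)

binom : ℤ → ℕ → ℚ
binom x k = (fallingℤ x k ℚ./ (k !)) {{k !≢0}}

-- Polynomials in q with rational coefficients, as coefficient lists
-- (constant term first).  Equality is coefficientwise.
Poly : Set
Poly = List ℚ

coeff : Poly → ℕ → ℚ
coeff []      _       = 0ℚ
coeff (a ∷ p) zero    = a
coeff (a ∷ p) (suc i) = coeff p i

_≈ₚ_ : Poly → Poly → Set
p ≈ₚ r = ∀ i → coeff p i ≡ coeff r i

infix 4 _≈ₚ_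
infixl 6 _+ₚ_
infixl 7 _*ₚ_ _·ₚ_

_+ₚ_ : Poly → Poly → Poly
[]      +ₚ r       = r
(a ∷ p) +ₚ []      = a ∷ p
(a ∷ p) +ₚ (b ∷ r) = (a ℚ.+ b) ∷ (p +ₚ r)

_·ₚ_ : ℚ → Poly → Poly
c ·ₚ []      = []
c ·ₚ (a ∷ p) = (c ℚ.* a) ∷ (c ·ₚ p)

_*ₚ_ : Poly → Poly → Poly
[]      *ₚ r = []
(a ∷ p) *ₚ r = (a ·ₚ r) +ₚ (0ℚ ∷ (p *ₚ r))

constₚ : ℚ → Poly
constₚ c = c ∷ []

0ₚ 1ₚ qₚ : Poly
0ₚ = []
1ₚ = constₚ 1ℚ
qₚ = 0ℚ ∷ 1ℚ ∷ []

q-1ₚ : Poly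
q-1ₚ = ℚ.- 1ℚ ∷ 1ℚ ∷ []

_^ₚ_ : Poly → ℕ → Poly
p ^ₚ zero  = 1ₚ
p ^ₚ suc m = p *ₚ (p ^ₚ m)

-- Σ_{i=a}^{b} f i  (empty if b < a)
sumFromTo : ℕ → ℕ → (ℕ → Poly) → Poly
sumFromTo a b f = go (suc b ℕ.∸ a) a
  where
  go : ℕ → ℕ → Poly
  go zero    i = 0ₚ
  go (suc c) i = f i +ₚ go c (suc i)

narayana : ℕ → Poly
narayana zero = 1ₚ
narayana n@(suc n-1) =
  sumFromTo 1 n λ k →
    ((+ 1 ℚ./ n) ℚ.* binom (+ n) (k ℕ.∸ 1) ℚ.* binom (+ n) k) ·ₚ (qₚ ^ₚ (k ℕ.∸ 1))

{-# OPTIONS --safe #-}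
module Submission where

-- In R[[s]] with R = ℚ[[q]] let ψ = (1 + s)(1 + q s).  Comparing coefficients,
-- r C_r(q) = [s^(r-1)] ψ^r; Lagrange inversion says that for every power series K
--
--   Σ_{k<r} C_{r-k}(q) [s^k] (K ψ^k) = [s^(r-1)] (K ψ^r).
--
-- This follows by induction on r: for s K it is the case r - 1 of K ψ, for
-- κ = 1 - s ψ′ / ψ it holds because [s^k] (κ ψ^k) = 0 when k > 0, and every K is
-- a combination of κ and a multiple of s.  The theorem is the case
-- K = (1 + s)^(-1) (1 + q s)^(n-2r+1), since
--
--   q^k Σ_m binom(b,m) (q-1)^m binom(x-m,k) = q^b [s^k] (1 + q s)^(x-b) (1 + s)^b
--
-- by the binomial theorem for ((1 + q s) + (q - 1))^b = (q (1 + s))^b.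

open import Defs
open import Algebra.Bundles using (CommutativeRing; Semiring)
open import Algebra.Morphism.Structures using (module SemiringMorphisms)
open import Data.Integer as ℤ using (ℤ; +_; -[1+_])
open import Data.Integer.Tactic.RingSolver using (solve-∀)
open import Data.List using ([]; _∷_)
open import Data.Nat as ℕ using (ℕ; zero; suc; _!; z≤n; s≤s)
open import Data.Nat.Properties using (_!≢0)
open import Data.Product using (_,_)
open import Data.Rational as ℚ using (ℚ; 0ℚ; 1ℚ)
open import Data.Rational.Unnormalised as ℚᵘ using (mkℚᵘ; *≡*)
open import Function using (_∘_)
open import Level using (_⊔_)
open import Relation.Binary.PropositionalEquality as ≡ using (_≡_)
import Algebra.Construct.Pointwise as Pointwise
import Algebra.Properties.CommutativeMonoid.Mult as CommutativeMonoidMult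
import Algebra.Properties.CommutativeSemigroup as CommutativeSemigroupProperties
import Algebra.Properties.CommutativeSemiring.Exp as CommutativeSemiringExp
import Algebra.Properties.Group as GroupProperties
import Algebra.Properties.Semiring.Exp as SemiringExp
import Algebra.Properties.Semiring.Mult as SemiringMult
import Algebra.Solver.Ring.NaturalCoefficients.Default as RingSolver
import Data.Integer.Properties as ℤ
import Data.Nat.Properties as ℕ
import Data.Rational.Properties as ℚ
import Data.Rational.Unnormalised.Properties as ℚᵘ
import Relation.Binary.Reasoning.Setoid as SetoidReasoning

-- Finite sums over initial segments of the naturals.

module RangeSum {c ℓ} (R : CommutativeRing c ℓ) where
  open CommutativeRing R
  open SetoidReasoning setoid

  -- Terms are split off at the front, as in the recursions of `_⊛_` and `sumFromTo`, so `⊛-coeff`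
  -- needs no reindexing.
  sum< : ℕ → (ℕ → Carrier) → Carrier
  sum< zero    f = 0#
  sum< (suc n) f = f 0 + sum< n (f ∘ suc)

  sum<-cong-< : ∀ n {f g} → (∀ i → i ℕ.< n → f i ≈ g i) → sum< n f ≈ sum< n g
  sum<-cong-< zero    p = refl
  sum<-cong-< (suc n) p = +-cong (p 0 (s≤s z≤n)) (sum<-cong-< n λ i i<n → p (suc i) (s≤s i<n))

  sum<-cong : ∀ n {f g} → (∀ i → f i ≈ g i) → sum< n f ≈ sum< n g
  sum<-cong n p = sum<-cong-< n λ i _ → p i

  sum<-zero : ∀ n → sum< n (λ _ → 0#) ≈ 0#
  sum<-zero zero    = refl
  sum<-zero (suc n) = trans (+-identityˡ _) (sum<-zero n)

  sum<-+ : ∀ n f g → sum< n (λ i → f i + g i) ≈ sum< n f + sum< n g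
  sum<-+ zero    f g = sym (+-identityˡ _)
  sum<-+ (suc n) f g = trans (+-congˡ (sum<-+ n (f ∘ suc) (g ∘ suc))) (interchange _ _ _ _)
    where open CommutativeSemigroupProperties +-commutativeSemigroup using (interchange)

  *-sum< : ∀ n x f → x * sum< n f ≈ sum< n (λ i → x * f i)
  *-sum< zero    x f = zeroʳ x
  *-sum< (suc n) x f = trans (distribˡ _ _ _) (+-congˡ (*-sum< n x (f ∘ suc)))

  sum<-last : ∀ n f → sum< (suc n) f ≈ sum< n f + f n
  sum<-last zero    f = +-comm _ _
  sum<-last (suc n) f = begin
    f 0 + sum< (suc n) (f ∘ suc)            ≈⟨ +-congˡ (sum<-last n (f ∘ suc)) ⟩
    f 0 + (sum< n (f ∘ suc) + f (suc n))    ≈⟨ +-assoc _ _ _ ⟨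
    sum< (suc n) f + f (suc n)              ∎

-- The commutative ring of formal power series in s.

module PowerSeries {c ℓ} (R : CommutativeRing c ℓ) where
  open CommutativeRing R
  open RangeSum R
  open RingSolver commutativeSemiring using (solve; _:=_; _:+_; _:*_)
  open SetoidReasoning setoid

  Series : Set c
  Series = ℕ → Carrier

  infix 4 _≋_
  _≋_ : Series → Series → Set ℓ
  f ≋ g = ∀ n → f n ≈ g n

  infixl 7 _⊛_
  infixr 5 _▹_

  -- The Cauchy product, obtained by writing the left factor as its constant term plus s
  -- (`f ∘ suc`). The recursion is structural in the degree, and `_*ₚ_` follows the same pattern,
  -- which keeps `coeff-*` short.
  _⊛_ : Series → Series → Series
  (f ⊛ g) zero    = f 0 * g 0
  (f ⊛ g) (suc n) = f 0 * g (suc n) + (f ∘ suc ⊛ g) n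

  -- x + s f
  _▹_ : Carrier → Series → Series
  (x ▹ f) zero    = x
  (x ▹ f) (suc n) = f n

  𝟎 : Series
  𝟎 _ = 0#

  const : Carrier → Series
  const x = x ▹ 𝟎

  ⊛-cong : ∀ {f f′ g g′} → f ≋ f′ → g ≋ g′ → f ⊛ g ≋ f′ ⊛ g′
  ⊛-cong p r zero    = *-cong (p 0) (r 0)
  ⊛-cong p r (suc n) = +-cong (*-cong (p 0) (r (suc n))) (⊛-cong (p ∘ suc) r n)

  ⊛-zeroˡ : ∀ g → 𝟎 ⊛ g ≋ 𝟎
  ⊛-zeroˡ g zero    = zeroˡ _
  ⊛-zeroˡ g (suc n) = trans (+-cong (zeroˡ _) (⊛-zeroˡ g n)) (+-identityˡ _)

  const-⊛ : ∀ x g n → (const x ⊛ g) n ≈ x * g n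
  const-⊛ x g zero    = refl
  const-⊛ x g (suc n) = trans (+-congˡ (⊛-zeroˡ g n)) (+-identityʳ _)

  ⊛-distribʳ : ∀ h f g → (λ n → f n + g n) ⊛ h ≋ λ n → (f ⊛ h) n + (g ⊛ h) n
  ⊛-distribʳ h f g zero    = distribʳ _ _ _
  ⊛-distribʳ h f g (suc n) = begin
    (f 0 + g 0) * h (suc n) + ((λ m → f (suc m) + g (suc m)) ⊛ h) n
      ≈⟨ +-congˡ (⊛-distribʳ h (f ∘ suc) (g ∘ suc) n) ⟩
    (f 0 + g 0) * h (suc n) + ((f ∘ suc ⊛ h) n + (g ∘ suc ⊛ h) n)
      ≈⟨ solve 5 (λ a b x u v → (a :+ b) :* x :+ (u :+ v) := (a :* x :+ u) :+ (b :* x :+ v)) refl _ _ _ _ _ ⟩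
    (f ⊛ h) (suc n) + (g ⊛ h) (suc n) ∎

  *-⊛-assoc : ∀ x f g n → ((λ m → x * f m) ⊛ g) n ≈ x * (f ⊛ g) n
  *-⊛-assoc x f g zero    = *-assoc _ _ _
  *-⊛-assoc x f g (suc n) = begin
    x * f 0 * g (suc n) + ((λ m → x * f (suc m)) ⊛ g) n
      ≈⟨ +-cong (*-assoc _ _ _) (*-⊛-assoc x (f ∘ suc) g n) ⟩
    x * (f 0 * g (suc n)) + x * (f ∘ suc ⊛ g) n
      ≈⟨ distribˡ _ _ _ ⟨
    x * (f ⊛ g) (suc n) ∎

  -- The recursion of `_⊛_` mirrored to the right factor. Commutativity follows by comparing the two
  -- recursions.
  ⊛-sucʳ : ∀ f g n → (f ⊛ g) (suc n) ≈ f (suc n) * g 0 + (f ⊛ g ∘ suc) n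
  ⊛-sucʳ f g zero    = +-comm _ _
  ⊛-sucʳ f g (suc n) = begin
    f 0 * g (suc (suc n)) + (f ∘ suc ⊛ g) (suc n)
      ≈⟨ +-congˡ (⊛-sucʳ (f ∘ suc) g n) ⟩
    f 0 * g (suc (suc n)) + (f (suc (suc n)) * g 0 + (f ∘ suc ⊛ g ∘ suc) n)
      ≈⟨ solve 3 (λ a b x → a :+ (b :+ x) := b :+ (a :+ x)) refl _ _ _ ⟩
    f (suc (suc n)) * g 0 + (f ⊛ g ∘ suc) (suc n) ∎

  ⊛-comm : ∀ f g → f ⊛ g ≋ g ⊛ f
  ⊛-comm f g zero    = *-comm _ _
  ⊛-comm f g (suc n) = begin
    f 0 * g (suc n) + (f ∘ suc ⊛ g) n   ≈⟨ +-cong (*-comm _ _) (⊛-comm (f ∘ suc) g n) ⟩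
    g (suc n) * f 0 + (g ⊛ f ∘ suc) n   ≈⟨ ⊛-sucʳ g f n ⟨
    (g ⊛ f) (suc n)                     ∎

  ⊛-assoc : ∀ f g h → (f ⊛ g) ⊛ h ≋ f ⊛ (g ⊛ h)
  ⊛-assoc f g h zero    = *-assoc _ _ _
  ⊛-assoc f g h (suc n) = begin
    f 0 * g 0 * h (suc n) + ((λ m → f 0 * g (suc m) + (f ∘ suc ⊛ g) m) ⊛ h) n
      ≈⟨ +-congˡ (⊛-distribʳ h (λ m → f 0 * g (suc m)) (f ∘ suc ⊛ g) n) ⟩
    f 0 * g 0 * h (suc n) + (((λ m → f 0 * g (suc m)) ⊛ h) n + ((f ∘ suc ⊛ g) ⊛ h) n)
      ≈⟨ +-congˡ (+-cong (*-⊛-assoc (f 0) (g ∘ suc) h n) (⊛-assoc (f ∘ suc) g h n)) ⟩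
    f 0 * g 0 * h (suc n) + (f 0 * (g ∘ suc ⊛ h) n + (f ∘ suc ⊛ (g ⊛ h)) n)
      ≈⟨ solve 5 (λ a b x u v → a :* b :* x :+ (a :* u :+ v) := a :* (b :* x :+ u) :+ v) refl _ _ _ _ _ ⟩
    (f ⊛ (g ⊛ h)) (suc n) ∎

  series : CommutativeRing c ℓ
  series = record
    { Carrier = Series
    ; _≈_ = _≋_
    ; _+_ = λ f g n → f n + g n
    ; _*_ = _⊛_
    ; -_ = λ f n → - f n
    ; 0# = 𝟎
    ; 1# = const 1#
    ; isCommutativeRing = record
      { isRing = record
        { +-isAbelianGroup = Pointwise.isAbelianGroup ℕ +-isAbelianGroup
        ; *-cong = ⊛-cong
        ; *-assoc = ⊛-assoc
        ; *-identity = identityˡ , λ f n → trans (⊛-comm f (const 1#) n) (identityˡ f n)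
        ; distrib = distribʳ⇒distribˡ , ⊛-distribʳ
        }
      ; *-comm = ⊛-comm
      }
    }
    where
    identityˡ : ∀ f → const 1# ⊛ f ≋ f
    identityˡ f n = trans (const-⊛ 1# f n) (*-identityˡ _)

    distribʳ⇒distribˡ : ∀ h f g → h ⊛ (λ n → f n + g n) ≋ λ n → (h ⊛ f) n + (h ⊛ g) n
    distribʳ⇒distribˡ h f g n = begin
      (h ⊛ (λ n → f n + g n)) n   ≈⟨ ⊛-comm h _ n ⟩
      ((λ n → f n + g n) ⊛ h) n   ≈⟨ ⊛-distribʳ h f g n ⟩
      (f ⊛ h) n + (g ⊛ h) n       ≈⟨ +-cong (⊛-comm f h n) (⊛-comm g h n) ⟩
      (h ⊛ f) n + (h ⊛ g) n       ∎

  ⊛-coeff : ∀ f g n → (f ⊛ g) n ≈ sum< (suc n) (λ i → f i * g (n ℕ.∸ i))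
  ⊛-coeff f g zero    = sym (+-identityʳ _)
  ⊛-coeff f g (suc n) = +-congˡ (⊛-coeff (f ∘ suc) g n)

-- The derivation s d/ds and logarithmic derivatives.

module Euler {c ℓ} (R : CommutativeRing c ℓ) where
  open CommutativeRing R
  open PowerSeries R
  module P = CommutativeRing series
  open SemiringMult semiring
  open CommutativeMonoidMult +-commutativeMonoid using (×-distrib-+)
  open SemiringExp P.semiring using (_^_)
  open SetoidReasoning setoid

  -- s d/ds
  θ : Series → Series
  θ f n = n × f n

  ×-zeroʳ : ∀ n → n × 0# ≈ 0#
  ×-zeroʳ zero    = refl
  ×-zeroʳ (suc n) = trans (+-identityˡ _) (×-zeroʳ n)

  ⊛-× : ∀ n f g → f ⊛ (λ m → n × g m) ≋ λ m → n × (f ⊛ g) m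
  ⊛-× zero    f g = P.zeroʳ f
  ⊛-× (suc n) f g m = trans (P.distribˡ f g (λ m → n × g m) m) (+-congˡ (⊛-× n f g m))

  -- The Leibniz rule. In degree n + 1, `suc n × y` is `y` plus `n × y`; the extra summand is
  -- absorbed because `θ f ∘ suc` unfolds to `f ∘ suc` plus `θ (f ∘ suc)`.
  θ-⊛ : ∀ f g → θ (f ⊛ g) ≋ θ f ⊛ g P.+ f ⊛ θ g
  θ-⊛ f g zero    = sym (trans (+-cong (zeroˡ _) (zeroʳ _)) (+-identityˡ _))
  θ-⊛ f g (suc n) = begin
    suc n × (f 0 * g (suc n) + (f ∘ suc ⊛ g) n)
      ≈⟨ ×-distrib-+ _ _ (suc n) ⟩
    suc n × (f 0 * g (suc n)) + ((f ∘ suc ⊛ g) n + θ (f ∘ suc ⊛ g) n)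
      ≈⟨ +-cong (sym (×-comm-* (suc n) _ _)) (+-congˡ (θ-⊛ (f ∘ suc) g n)) ⟩
    f 0 * θ g (suc n) + ((f ∘ suc ⊛ g) n + ((θ (f ∘ suc) ⊛ g) n + (f ∘ suc ⊛ θ g) n))
      ≈⟨ +-congˡ (+-assoc _ _ _) ⟨
    f 0 * θ g (suc n) + (((f ∘ suc ⊛ g) n + (θ (f ∘ suc) ⊛ g) n) + (f ∘ suc ⊛ θ g) n)
      ≈⟨ +-congˡ (+-congʳ (⊛-distribʳ g (f ∘ suc) (θ (f ∘ suc)) n)) ⟨
    f 0 * θ g (suc n) + ((θ f ∘ suc ⊛ g) n + (f ∘ suc ⊛ θ g) n)
      -- The constant term of `θ f` is `0 × f 0`, hence zero, so its product with `g (suc n)` can be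
      -- put back in front.
      ≈⟨ +-congˡ (+-congʳ (trans (+-congʳ (zeroˡ _)) (+-identityˡ _))) ⟨
    f 0 * θ g (suc n) + ((θ f ⊛ g) (suc n) + (f ∘ suc ⊛ θ g) n)
      ≈⟨ solve 3 (λ a b x → a :+ (b :+ x) := b :+ (a :+ x)) refl _ _ _ ⟩
    (θ f ⊛ g) (suc n) + (f ⊛ θ g) (suc n) ∎
    where open RingSolver commutativeSemiring using (solve; _:=_; _:+_)

  module LogarithmicDerivative
    (ψ ψ⁻¹ : Series) (inverse : ψ⁻¹ ⊛ ψ ≋ P.1#) where

    -- The logarithmic derivative s ψ′ / ψ.
    ℒ : Series
    ℒ = θ ψ ⊛ ψ⁻¹

    ℒ⊛ψ : ℒ ⊛ ψ ≋ θ ψ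
    ℒ⊛ψ = P.trans (P.*-assoc (θ ψ) ψ⁻¹ ψ)
         (P.trans (P.*-congˡ {x = θ ψ} inverse) (P.*-identityʳ (θ ψ)))

    -- Induction with the Leibniz rule. In degree m it reads m [s^m] ψ^n = n [s^m] (ψ^n ℒ), which
    -- trades multiplication by `ℒ` for integer multiples of coefficients of ψ^n.
    θ-^ : ∀ n → θ (ψ ^ n) ≋ λ m → n × (ψ ^ n ⊛ ℒ) m
    θ-^ zero    zero    = refl
    θ-^ zero    (suc m) = ×-zeroʳ (suc m)
    θ-^ (suc n) m = begin
      θ (ψ ⊛ ψ ^ n) m                              ≈⟨ θ-⊛ ψ (ψ ^ n) m ⟩
      (θ ψ ⊛ ψ ^ n) m + (ψ ⊛ θ (ψ ^ n)) m          ≈⟨ +-cong (fst m) (snd m) ⟩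
      (ψ ^ suc n ⊛ ℒ) m + n × (ψ ^ suc n ⊛ ℒ) m    ∎
      where
      fst : θ ψ ⊛ ψ ^ n ≋ ψ ^ suc n ⊛ ℒ
      fst = P.trans (P.*-congʳ {x = ψ ^ n} (P.sym ℒ⊛ψ))
           (P.trans (P.*-assoc ℒ ψ (ψ ^ n)) (P.*-comm ℒ (ψ ^ suc n)))

      snd : ψ ⊛ θ (ψ ^ n) ≋ λ m → n × (ψ ^ suc n ⊛ ℒ) m
      snd m = begin
        (ψ ⊛ θ (ψ ^ n)) m                      ≈⟨ P.*-congˡ {x = ψ} (θ-^ n) m ⟩
        (ψ ⊛ (λ m → n × (ψ ^ n ⊛ ℒ) m)) m      ≈⟨ ⊛-× n ψ (ψ ^ n ⊛ ℒ) m ⟩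
        n × (ψ ⊛ (ψ ^ n ⊛ ℒ)) m                ≈⟨ ×-congʳ n (P.*-assoc ψ (ψ ^ n) ℒ m) ⟨
        n × (ψ ^ suc n ⊛ ℒ) m                  ∎

-- Lagrange inversion in convolution form.

module Lagrange {c ℓ} (R : CommutativeRing c ℓ) where
  open CommutativeRing R
  open RangeSum R
  open PowerSeries R
  open Euler R
  open SemiringMult semiring
  open CommutativeMonoidMult +-commutativeMonoid using (×-distrib-+)
  open SemiringExp P.semiring using (_^_)
  open GroupProperties +-group using (∙-cancelʳ; identityˡ-unique)
  open SetoidReasoning setoid

  module Inversion
    (×-cancel : ∀ n {x y} → suc n × x ≈ suc n × y → x ≈ y)
    (ψ ψ⁻¹ : Series) (inverse : ψ⁻¹ ⊛ ψ ≋ P.1#)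
    (C : ℕ → Carrier) (C-coeff : ∀ n → suc n × C (suc n) ≈ (ψ ^ suc n) n)
    where
    open LogarithmicDerivative ψ ψ⁻¹ inverse

    κ : Series
    κ = P.1# P.- ℒ

    κ+ℒ : κ P.+ ℒ ≋ P.1#
    κ+ℒ n = trans (+-assoc _ _ _) (trans (+-congˡ (-‿inverseˡ _)) (+-identityʳ _))

    κ⊛-split : ∀ n m → (κ ⊛ ψ ^ n) m + (ψ ^ n ⊛ ℒ) m ≈ (ψ ^ n) m
    κ⊛-split n m = begin
      (κ ⊛ ψ ^ n) m + (ψ ^ n ⊛ ℒ) m   ≈⟨ +-congˡ (P.*-comm (ψ ^ n) ℒ m) ⟩
      (κ ⊛ ψ ^ n) m + (ℒ ⊛ ψ ^ n) m   ≈⟨ P.distribʳ (ψ ^ n) κ ℒ m ⟨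
      ((κ P.+ ℒ) ⊛ ψ ^ n) m           ≈⟨ P.*-congʳ {x = ψ ^ n} κ+ℒ m ⟩
      (P.1# ⊛ ψ ^ n) m                ≈⟨ P.*-identityˡ (ψ ^ n) m ⟩
      (ψ ^ n) m                       ∎

    -- In `θ-^` the degree and the exponent coincide here, so the common multiple cancels: ψ^(n+1)
    -- and ψ^(n+1) ℒ have the same coefficient at s^(n+1), and `κ⊛-split` leaves nothing for κ.
    κ⊛-diagonal : ∀ n → (κ ⊛ ψ ^ suc n) (suc n) ≈ 0#
    κ⊛-diagonal n = identityˡ-unique _ _ (begin
      (κ ⊛ ψ ^ suc n) (suc n) + (ψ ^ suc n) (suc n)
        ≈⟨ +-congˡ (×-cancel n (θ-^ (suc n) (suc n))) ⟩
      (κ ⊛ ψ ^ suc n) (suc n) + (ψ ^ suc n ⊛ ℒ) (suc n)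
        ≈⟨ κ⊛-split (suc n) (suc n) ⟩
      (ψ ^ suc n) (suc n) ∎)

    -- One degree below the exponent, `θ-^` accounts for n of the n + 1 copies of [s^n] ψ^(n+1). The
    -- single copy left over is (n+1) C_(n+1) by `C-coeff`. The n copies are added to both sides and
    -- cancelled, which avoids subtraction.
    κ⊛-subdiagonal : ∀ n → (κ ⊛ ψ ^ suc n) n ≈ C (suc n)
    κ⊛-subdiagonal n = ×-cancel n (∙-cancelʳ (n × (ψ ^ suc n) n) _ _ (begin
      suc n × (κ ⊛ ψ ^ suc n) n + n × (ψ ^ suc n) n
        ≈⟨ +-congˡ (θ-^ (suc n) n) ⟩
      suc n × (κ ⊛ ψ ^ suc n) n + suc n × (ψ ^ suc n ⊛ ℒ) n
        ≈⟨ ×-distrib-+ _ _ (suc n) ⟨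
      suc n × ((κ ⊛ ψ ^ suc n) n + (ψ ^ suc n ⊛ ℒ) n)
        ≈⟨ ×-congʳ (suc n) (κ⊛-split (suc n) n) ⟩
      (ψ ^ suc n) n + n × (ψ ^ suc n) n
        ≈⟨ +-congʳ (C-coeff n) ⟨
      suc n × C (suc n) + n × (ψ ^ suc n) n ∎))

    -- The range k < r keeps the index of `C` positive, where `C-coeff` determines its value.
    convolution : ℕ → Series → Carrier
    convolution r K = sum< r (λ k → C (r ℕ.∸ k) * (K ⊛ ψ ^ k) k)

    -- The value at `zero` stands for the coefficient of s^(-1). It agrees with the empty
    -- convolution, so the induction can start at r = 0.
    target : ℕ → Series → Carrier
    target zero    K = 0#
    target (suc r) K = (K ⊛ ψ ^ suc r) r

    Inverts : ℕ → Series → Set ℓ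
    Inverts r K = convolution r K ≈ target r K

    target-cong : ∀ r {K K′} → K ≋ K′ → target r K ≈ target r K′
    target-cong zero    p = refl
    target-cong (suc r) p = P.*-congʳ {x = ψ ^ suc r} p r

    convolution-cong : ∀ r {K K′} → K ≋ K′ → convolution r K ≈ convolution r K′
    convolution-cong r p = sum<-cong r λ k → *-congˡ (P.*-congʳ {x = ψ ^ k} p k)

    inverts-cong : ∀ r {K K′} → K ≋ K′ → Inverts r K → Inverts r K′
    inverts-cong r p h = trans (convolution-cong r (P.sym p)) (trans h (target-cong r p))

    inverts-+ : ∀ r {K K′} → Inverts r K → Inverts r K′ → Inverts r (K P.+ K′)
    inverts-+ r {K} {K′} h h′ = begin
      convolution r (K P.+ K′)
        ≈⟨ sum<-cong r (λ k → trans (*-congˡ (P.distribʳ (ψ ^ k) K K′ k)) (distribˡ _ _ _)) ⟩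
      sum< r (λ k → C (r ℕ.∸ k) * (K ⊛ ψ ^ k) k + C (r ℕ.∸ k) * (K′ ⊛ ψ ^ k) k)
        ≈⟨ sum<-+ r _ _ ⟩
      convolution r K + convolution r K′   ≈⟨ +-cong h h′ ⟩
      target r K + target r K′             ≈⟨ target-+ r ⟩
      target r (K P.+ K′)                  ∎
      where
      target-+ : ∀ r → target r K + target r K′ ≈ target r (K P.+ K′)
      target-+ zero    = +-identityˡ _
      target-+ (suc r) = sym (P.distribʳ (ψ ^ suc r) K K′ r)

    inverts-scale : ∀ r x {K} → Inverts r K → Inverts r (λ n → x * K n)
    inverts-scale r x {K} h = begin
      convolution r (λ n → x * K n)
        ≈⟨ sum<-cong r (λ k → trans (*-congˡ (*-⊛-assoc x K (ψ ^ k) k)) (x∙yz≈y∙xz _ _ _)) ⟩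
      sum< r (λ k → x * (C (r ℕ.∸ k) * (K ⊛ ψ ^ k) k))   ≈⟨ *-sum< r x _ ⟨
      x * convolution r K                                ≈⟨ *-congˡ h ⟩
      x * target r K                                     ≈⟨ target-scale r ⟩
      target r (λ n → x * K n)                           ∎
      where
      open import Algebra.Properties.CommutativeSemigroup *-commutativeSemigroup
        using (x∙yz≈y∙xz)
      target-scale : ∀ r → x * target r K ≈ target r (λ n → x * K n)
      target-scale zero    = zeroʳ x
      target-scale (suc r) = sym (*-⊛-assoc x K (ψ ^ suc r) r)

    shift-⊛-suc : ∀ K g n → ((0# ▹ K) ⊛ g) (suc n) ≈ (K ⊛ g) n
    shift-⊛-suc K g n = trans (+-congʳ (zeroˡ _)) (+-identityˡ _)

    -- The series s K has no constant term, so the summand k = 0 disappears. In the others one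
    -- factor s cancels against one degree and one factor ψ moves into the series: [s^(k+1)] (s K
    -- ψ^(k+1)) = [s^k] (K ψ ψ^k).
    inverts-shift : ∀ r {K} → Inverts r (K ⊛ ψ) → Inverts (suc r) (0# ▹ K)
    inverts-shift r {K} h = begin
      C (suc r) * (0# * 1#) + sum< r (λ k → C (r ℕ.∸ k) * ((0# ▹ K) ⊛ ψ ^ suc k) (suc k))
        ≈⟨ +-cong (trans (*-congˡ (zeroˡ _)) (zeroʳ _)) (sum<-cong r λ k → *-congˡ (step k k)) ⟩
      0# + convolution r (K ⊛ ψ)
        ≈⟨ +-identityˡ _ ⟩
      convolution r (K ⊛ ψ)
        ≈⟨ h ⟩
      target r (K ⊛ ψ)
        ≈⟨ target-shift r ⟩
      target (suc r) (0# ▹ K) ∎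
      where
      step : ∀ k n → ((0# ▹ K) ⊛ ψ ^ suc k) (suc n) ≈ ((K ⊛ ψ) ⊛ ψ ^ k) n
      step k n = trans (shift-⊛-suc K (ψ ^ suc k) n) (P.sym (P.*-assoc K ψ (ψ ^ k)) n)

      target-shift : ∀ r → target r (K ⊛ ψ) ≈ target (suc r) (0# ▹ K)
      target-shift zero    = sym (zeroˡ _)
      target-shift (suc r) = sym (step (suc r) r)

    -- By `κ⊛-diagonal` only the summand k = 0 survives; κ has constant term 1, so it equals
    -- `C (suc r)`, which is the target by `κ⊛-subdiagonal`.
    inverts-κ : ∀ r → Inverts (suc r) κ
    inverts-κ r = begin
      C (suc r) * (κ 0 * 1#) + sum< r (λ k → C (r ℕ.∸ k) * (κ ⊛ ψ ^ suc k) (suc k))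
        ≈⟨ +-cong (*-congˡ (trans (*-identityʳ _) κ₀)) (sum<-cong r λ k → trans (*-congˡ (κ⊛-diagonal k)) (zeroʳ _)) ⟩
      C (suc r) * 1# + sum< r (λ _ → 0#)
        ≈⟨ +-cong (*-identityʳ _) (sum<-zero r) ⟩
      C (suc r) + 0#
        ≈⟨ +-identityʳ _ ⟩
      C (suc r)
        ≈⟨ κ⊛-subdiagonal r ⟨
      (κ ⊛ ψ ^ suc r) r ∎
      where
      κ₀ : κ 0 ≈ 1#
      κ₀ = trans (sym (+-identityʳ _)) (trans (+-congˡ (sym (zeroˡ _))) (κ+ℒ 0))

    -- The series stays universally quantified because the induction hypothesis is applied to a
    -- different one, `K′ ⊛ ψ`.
    inverts : ∀ r K → Inverts r K
    inverts zero    K = refl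
    inverts (suc r) K = inverts-cong (suc r) decompose
      (inverts-+ (suc r)
        (inverts-scale (suc r) (K 0) (inverts-κ r))
        (inverts-shift r (inverts r (K′ ⊛ ψ))))
      where
      -- Solves K = K₀ κ + s K′ for K′, where K₀ is the constant term of K. As κ = 1 - ℒ, the
      -- coefficients of K - K₀ κ in positive degree are those of K + K₀ ℒ.
      K′ : Series
      K′ n = K (suc n) + K 0 * ℒ (suc n)

      decompose : (λ n → K 0 * κ n) P.+ (0# ▹ K′) ≋ K
      decompose zero = begin
        K 0 * κ 0 + 0#         ≈⟨ +-congˡ (trans (*-congˡ (zeroˡ _)) (zeroʳ _)) ⟨
        K 0 * κ 0 + K 0 * ℒ 0  ≈⟨ distribˡ _ _ _ ⟨
        K 0 * (κ 0 + ℒ 0)      ≈⟨ *-congˡ (κ+ℒ 0) ⟩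
        K 0 * 1#               ≈⟨ *-identityʳ _ ⟩
        K 0                    ∎
      decompose (suc n) = begin
        K 0 * κ (suc n) + (K (suc n) + K 0 * ℒ (suc n))
          ≈⟨ solve 4 (λ a k x l → a :* k :+ (x :+ a :* l) := a :* (k :+ l) :+ x) refl _ _ _ _ ⟩
        K 0 * (κ (suc n) + ℒ (suc n)) + K (suc n)
          ≈⟨ +-congʳ (trans (*-congˡ (κ+ℒ (suc n))) (zeroʳ _)) ⟩
        0# + K (suc n)
          ≈⟨ +-identityˡ _ ⟩
        K (suc n) ∎
        where open RingSolver commutativeSemiring using (solve; _:=_; _:+_; _:*_)

-- Binomial coefficients with an arbitrary integer on top.

module Binomials where
  open ≡ using (sym; trans; cong; cong₂; subst; refl)
  open ≡.≡-Reasoning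

  fromℤ : ℤ → ℚ
  fromℤ z = z ℚ./ 1

  private
    toℚᵘ-/ : ∀ z d .{{_ : ℕ.NonZero d}} → ℚ.toℚᵘ (z ℚ./ d) ℚᵘ.≃ z ℚᵘ./ d
    toℚᵘ-/ z (suc d) = ℚ.toℚᵘ-fromℚᵘ (mkℚᵘ z d)

  fromℤ-+ : ∀ a b → fromℤ (a ℤ.+ b) ≡ fromℤ a ℚ.+ fromℤ b
  fromℤ-+ a b = ℚ.toℚᵘ-injective
    (ℚᵘ.≃-trans (toℚᵘ-/ (a ℤ.+ b) 1)
    (ℚᵘ.≃-trans (*≡* (eq a b))
    (ℚᵘ.≃-trans (ℚᵘ.+-cong (ℚᵘ.≃-sym (toℚᵘ-/ a 1)) (ℚᵘ.≃-sym (toℚᵘ-/ b 1)))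
      (ℚᵘ.≃-sym (ℚ.toℚᵘ-homo-+ (fromℤ a) (fromℤ b))))))
    where
    eq : ∀ a b → (a ℤ.+ b) ℤ.* + 1 ≡ (a ℤ.* + 1 ℤ.+ b ℤ.* + 1) ℤ.* + 1
    eq = solve-∀

  fromℤ-* : ∀ a b → fromℤ (a ℤ.* b) ≡ fromℤ a ℚ.* fromℤ b
  fromℤ-* a b = ℚ.toℚᵘ-injective
    (ℚᵘ.≃-trans (toℚᵘ-/ (a ℤ.* b) 1)
    (ℚᵘ.≃-trans (ℚᵘ.*-cong (ℚᵘ.≃-sym (toℚᵘ-/ a 1)) (ℚᵘ.≃-sym (toℚᵘ-/ b 1)))
      (ℚᵘ.≃-sym (ℚ.toℚᵘ-homo-* (fromℤ a) (fromℤ b)))))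

  /-cancel : ∀ z d .{{_ : ℕ.NonZero d}} → fromℤ (+ d) ℚ.* (z ℚ./ d) ≡ fromℤ z
  /-cancel z d@(suc _) = ℚ.toℚᵘ-injective
    (ℚᵘ.≃-trans (ℚ.toℚᵘ-homo-* (fromℤ (+ d)) (z ℚ./ d))
    (ℚᵘ.≃-trans (ℚᵘ.*-cong (toℚᵘ-/ (+ d) 1) (toℚᵘ-/ z d))
    (ℚᵘ.≃-trans (*≡* (trans (eq (+ d) z) (cong (λ e → z ℤ.* + e) (sym (ℕ.+-identityʳ d)))))
      (ℚᵘ.≃-sym (toℚᵘ-/ z 1)))))
    where
    eq : ∀ a b → a ℤ.* b ℤ.* + 1 ≡ b ℤ.* a
    eq = solve-∀

  fromℤ-cancel : ∀ d .{{_ : ℕ.NonZero d}} {x y} →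
                 fromℤ (+ d) ℚ.* x ≡ fromℤ (+ d) ℚ.* y → x ≡ y
  fromℤ-cancel d {x} {y} eq = trans (sym (invert x)) (trans (cong (+ 1 ℚ./ d ℚ.*_) eq) (invert y))
    where
    invert : ∀ x → (+ 1 ℚ./ d) ℚ.* (fromℤ (+ d) ℚ.* x) ≡ x
    invert x = begin
      (+ 1 ℚ./ d) ℚ.* (fromℤ (+ d) ℚ.* x)   ≡⟨ ℚ.*-assoc (+ 1 ℚ./ d) (fromℤ (+ d)) x ⟨
      (+ 1 ℚ./ d) ℚ.* fromℤ (+ d) ℚ.* x     ≡⟨ cong (ℚ._* x) (ℚ.*-comm (+ 1 ℚ./ d) _) ⟩
      fromℤ (+ d) ℚ.* (+ 1 ℚ./ d) ℚ.* x     ≡⟨ cong (ℚ._* x) (/-cancel (+ 1) d) ⟩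
      1ℚ ℚ.* x                              ≡⟨ ℚ.*-identityˡ x ⟩
      x                                     ∎

  -- Clears the denominator: facts about `binom` are reduced to integer identities for `fallingℤ`
  -- and carried back with `fromℤ-cancel`.
  !*binom : ∀ x k → fromℤ (+ (k !)) ℚ.* binom x k ≡ fromℤ (fallingℤ x k)
  !*binom x k = /-cancel (fallingℤ x k) (k !) {{k !≢0}}

  -- Pascal's rule multiplied by (k+1)!. Without denominators the induction step is a polynomial
  -- identity over ℤ, valid for either sign of x.
  fallingℤ-suc : ∀ x k → fallingℤ (ℤ.suc x) (suc k) ≡ fallingℤ x (suc k) ℤ.+ + suc k ℤ.* fallingℤ x k
  fallingℤ-suc x zero    = eq x
    where
    eq : ∀ x → + 1 ℤ.* (+ 1 ℤ.+ x ℤ.- + 0) ≡ + 1 ℤ.* (x ℤ.- + 0) ℤ.+ + 1 ℤ.* + 1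
    eq = solve-∀
  fallingℤ-suc x (suc k) = trans (cong (ℤ._* (ℤ.suc x ℤ.- + suc k)) (fallingℤ-suc x k))
                                 (eq (fallingℤ x k) x (+ k))
    where
    eq : ∀ f x k → (f ℤ.* (x ℤ.- k) ℤ.+ (+ 1 ℤ.+ k) ℤ.* f) ℤ.* (+ 1 ℤ.+ x ℤ.- (+ 1 ℤ.+ k))
         ≡ f ℤ.* (x ℤ.- k) ℤ.* (x ℤ.- (+ 1 ℤ.+ k)) ℤ.+ (+ 1 ℤ.+ (+ 1 ℤ.+ k)) ℤ.* (f ℤ.* (x ℤ.- k))
    eq = solve-∀

  pascal : ∀ x k → binom (ℤ.suc x) (suc k) ≡ binom x (suc k) ℚ.+ binom x k
  pascal x k = fromℤ-cancel (suc k !) {{suc k !≢0}} (begin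
    fromℤ (+ (suc k !)) ℚ.* binom (ℤ.suc x) (suc k)
      ≡⟨ !*binom (ℤ.suc x) (suc k) ⟩
    fromℤ (fallingℤ (ℤ.suc x) (suc k))
      ≡⟨ cong fromℤ (fallingℤ-suc x k) ⟩
    fromℤ (fallingℤ x (suc k) ℤ.+ + suc k ℤ.* fallingℤ x k)
      ≡⟨ fromℤ-+ (fallingℤ x (suc k)) (+ suc k ℤ.* fallingℤ x k) ⟩
    fromℤ (fallingℤ x (suc k)) ℚ.+ fromℤ (+ suc k ℤ.* fallingℤ x k)
      ≡⟨ cong₂ ℚ._+_ (sym (!*binom x (suc k))) absorb ⟩
    fromℤ (+ (suc k !)) ℚ.* binom x (suc k) ℚ.+ fromℤ (+ (suc k !)) ℚ.* binom x k
      ≡⟨ ℚ.*-distribˡ-+ (fromℤ (+ (suc k !))) (binom x (suc k)) (binom x k) ⟨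
    fromℤ (+ (suc k !)) ℚ.* (binom x (suc k) ℚ.+ binom x k) ∎)
    where
    absorb : fromℤ (+ suc k ℤ.* fallingℤ x k) ≡ fromℤ (+ (suc k !)) ℚ.* binom x k
    absorb = begin
      fromℤ (+ suc k ℤ.* fallingℤ x k)
        ≡⟨ fromℤ-* (+ suc k) (fallingℤ x k) ⟩
      fromℤ (+ suc k) ℚ.* fromℤ (fallingℤ x k)
        ≡⟨ cong (fromℤ (+ suc k) ℚ.*_) (!*binom x k) ⟨
      fromℤ (+ suc k) ℚ.* (fromℤ (+ (k !)) ℚ.* binom x k)
        ≡⟨ ℚ.*-assoc (fromℤ (+ suc k)) (fromℤ (+ (k !))) (binom x k) ⟨
      fromℤ (+ suc k) ℚ.* fromℤ (+ (k !)) ℚ.* binom x k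
        ≡⟨ cong (ℚ._* binom x k) (trans (cong fromℤ (ℤ.pos-* (suc k) (k !))) (fromℤ-* (+ suc k) (+ (k !)))) ⟨
      fromℤ (+ (suc k !)) ℚ.* binom x k ∎

  fallingℤ≡0⇒binom≡0 : ∀ x k → fallingℤ x k ≡ + 0 → binom x k ≡ 0ℚ
  fallingℤ≡0⇒binom≡0 x k eq = fromℤ-cancel (k !) {{k !≢0}}
    (trans (!*binom x k) (trans (cong fromℤ eq) (sym (ℚ.*-zeroʳ (fromℤ (+ (k !)))))))

  binom[0,1+k]≡0 : ∀ k → binom (+ 0) (suc k) ≡ 0ℚ
  binom[0,1+k]≡0 k = fallingℤ≡0⇒binom≡0 (+ 0) (suc k) (falling k)
    where
    falling : ∀ k → fallingℤ (+ 0) (suc k) ≡ + 0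
    falling zero    = refl
    falling (suc k) = cong (ℤ._* (+ 0 ℤ.- + suc k)) (falling k)

  binom[n,1+n]≡0 : ∀ n → binom (+ n) (suc n) ≡ 0ℚ
  binom[n,1+n]≡0 n = fallingℤ≡0⇒binom≡0 (+ n) (suc n)
    (trans (cong (fallingℤ (+ n) n ℤ.*_) (ℤ.+-inverseʳ (+ n))) (ℤ.*-zeroʳ (fallingℤ (+ n) n)))

  binom[n,n]≡1 : ∀ n → binom (+ n) n ≡ 1ℚ
  binom[n,n]≡1 zero    = refl
  binom[n,n]≡1 (suc n) = trans (pascal (+ n) n) (cong₂ ℚ._+_ (binom[n,1+n]≡0 n) (binom[n,n]≡1 n))

  -- Indexing by the two lower entries avoids truncated subtraction. Pascal's rule on both sides
  -- produces the same two terms in opposite order, matched by the hypotheses for (i+1, j) and (i,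
  -- j+1).
  binom-sym : ∀ i j → binom (+ (i ℕ.+ j)) i ≡ binom (+ (i ℕ.+ j)) j
  binom-sym zero    j = sym (binom[n,n]≡1 j)
  binom-sym (suc i) zero rewrite ℕ.+-identityʳ i = binom[n,n]≡1 (suc i)
  binom-sym (suc i) (suc j) = begin
    binom (+ suc n) (suc i)                        ≡⟨ pascal (+ n) i ⟩
    binom (+ n) (suc i) ℚ.+ binom (+ n) i          ≡⟨ cong₂ ℚ._+_ ih (binom-sym i (suc j)) ⟩
    binom (+ n) j ℚ.+ binom (+ n) (suc j)          ≡⟨ ℚ.+-comm (binom (+ n) j) (binom (+ n) (suc j)) ⟩
    binom (+ n) (suc j) ℚ.+ binom (+ n) j          ≡⟨ pascal (+ n) j ⟨
    binom (+ suc n) (suc j)                        ∎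
    where
    n = i ℕ.+ suc j
    ih : binom (+ n) (suc i) ≡ binom (+ n) j
    ih = subst (λ m → binom (+ m) (suc i) ≡ binom (+ m) j) (sym (ℕ.+-suc i j)) (binom-sym (suc i) j)

-- The structure of ℚ[[q]] on which the computation rests.

record PointedℚAlgebra {c ℓ} (R : CommutativeRing c ℓ) : Set (c ⊔ ℓ) where
  open CommutativeRing R
  field
    ⟨_⟩ : ℚ → Carrier
    ⟨⟩-isHomomorphism : SemiringMorphisms.IsSemiringHomomorphism
      ℚ.+-*-rawSemiring (Semiring.rawSemiring semiring) ⟨_⟩
    -- `ε` is q - 1, characterised additively so that the semiring solver applies. Division by q is
    -- replaced by `q-cancel`.
    q ε : Carrier
    1+ε≈q : 1# + ε ≈ q
    q-cancel : ∀ {x y} → q * x ≈ q * y → x ≈ y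

-- Integer powers of linear series, with rational scalars.

module NarayanaIdentity {c ℓ} (R : CommutativeRing c ℓ) (S : PointedℚAlgebra R) where
  open CommutativeRing R
  open PointedℚAlgebra S
  open Binomials
  open RangeSum R
  open PowerSeries R
  open Euler R using (module P)
  open SemiringMult semiring using (_×_)
  open SemiringExp semiring using (_^_)
  module PE = SemiringExp P.semiring
  open SemiringMorphisms.IsSemiringHomomorphism ⟨⟩-isHomomorphism
    using (+-homo; *-homo; 0#-homo; 1#-homo)
  open RingSolver commutativeSemiring using (solve; _:=_; _:+_; _:*_)
  open CommutativeSemigroupProperties *-commutativeSemigroup using (x∙yz≈y∙xz)
  open SetoidReasoning setoid

  ⟨⟩-cong : ∀ {x y} → x ≡ y → ⟨ x ⟩ ≈ ⟨ y ⟩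
  ⟨⟩-cong eq = reflexive (≡.cong ⟨_⟩ eq)

  ×-⟨⟩ : ∀ n x → n × x ≈ ⟨ fromℤ (+ n) ⟩ * x
  ×-⟨⟩ zero    x = sym (trans (*-congʳ 0#-homo) (zeroˡ x))
  ×-⟨⟩ (suc n) x = begin
    x + n × x                               ≈⟨ +-cong (*-identityˡ x) (sym (×-⟨⟩ n x)) ⟨
    1# * x + ⟨ fromℤ (+ n) ⟩ * x            ≈⟨ distribʳ x _ _ ⟨
    (1# + ⟨ fromℤ (+ n) ⟩) * x              ≈⟨ *-congʳ (+-congʳ 1#-homo) ⟨
    (⟨ 1ℚ ⟩ + ⟨ fromℤ (+ n) ⟩) * x          ≈⟨ *-congʳ (+-homo _ _) ⟨
    ⟨ 1ℚ ℚ.+ fromℤ (+ n) ⟩ * x              ≈⟨ *-congʳ (⟨⟩-cong (fromℤ-+ (+ 1) (+ n))) ⟨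
    ⟨ fromℤ (+ suc n) ⟩ * x                 ∎

  ×-/ : ∀ n x → suc n × (⟨ + 1 ℚ./ suc n ⟩ * x) ≈ x
  ×-/ n x = begin
    suc n × (⟨ + 1 ℚ./ suc n ⟩ * x)                  ≈⟨ ×-⟨⟩ (suc n) _ ⟩
    ⟨ fromℤ (+ suc n) ⟩ * (⟨ + 1 ℚ./ suc n ⟩ * x)    ≈⟨ *-assoc _ _ _ ⟨
    ⟨ fromℤ (+ suc n) ⟩ * ⟨ + 1 ℚ./ suc n ⟩ * x      ≈⟨ *-congʳ (*-homo _ _) ⟨
    ⟨ fromℤ (+ suc n) ℚ.* (+ 1 ℚ./ suc n) ⟩ * x      ≈⟨ *-congʳ (⟨⟩-cong (/-cancel (+ 1) (suc n))) ⟩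
    ⟨ 1ℚ ⟩ * x                                       ≈⟨ *-congʳ 1#-homo ⟩
    1# * x                                           ≈⟨ *-identityˡ x ⟩
    x                                                ∎

  ×-cancel : ∀ n {x y} → suc n × x ≈ suc n × y → x ≈ y
  ×-cancel n {x} {y} eq = trans (sym (unscale x)) (trans (*-congˡ eq) (unscale y))
    where
    unscale : ∀ x → ⟨ + 1 ℚ./ suc n ⟩ * suc n × x ≈ x
    unscale x = trans (SemiringMult.×-comm-* semiring (suc n) _ x) (×-/ n x)

  -- 1 + y s
  lin : Carrier → Series
  lin y = 1# ▹ const y

  lin-⊛-suc : ∀ y f n → (lin y ⊛ f) (suc n) ≈ f (suc n) + y * f n
  lin-⊛-suc y f n = +-cong (*-identityˡ _) (const-⊛ y f n)

  -- (1 + y s)^N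
  lin^ : Carrier → ℤ → Series
  lin^ y N k = ⟨ binom N k ⟩ * y ^ k

  lin^-zero : ∀ y N → lin^ y N 0 ≈ 1#
  lin^-zero y N = trans (*-identityʳ _) 1#-homo

  -- Pascal's rule read coefficient by coefficient. It holds for every integer exponent, so at N =
  -- -1 it already exhibits the inverse of 1 + y s.
  lin^-suc : ∀ y N → lin^ y (ℤ.suc N) P.≈ lin y ⊛ lin^ y N
  lin^-suc y N zero    = trans (lin^-zero y (ℤ.suc N))
                               (sym (trans (*-identityˡ _) (lin^-zero y N)))
  lin^-suc y N (suc k) = begin
    ⟨ binom (ℤ.suc N) (suc k) ⟩ * (y * y ^ k)
      ≈⟨ *-congʳ (trans (⟨⟩-cong (pascal N k)) (+-homo _ _)) ⟩
    (⟨ binom N (suc k) ⟩ + ⟨ binom N k ⟩) * (y * y ^ k)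
      ≈⟨ solve 4 (λ a b y z → (a :+ b) :* (y :* z) := a :* (y :* z) :+ y :* (b :* z)) refl _ _ _ _ ⟩
    lin^ y N (suc k) + y * lin^ y N k
      ≈⟨ lin-⊛-suc y (lin^ y N) k ⟨
    (lin y ⊛ lin^ y N) (suc k) ∎

  lin^-0 : ∀ y → lin^ y (+ 0) P.≈ P.1#
  lin^-0 y zero    = lin^-zero y (+ 0)
  lin^-0 y (suc k) = trans (*-congʳ (trans (⟨⟩-cong (binom[0,1+k]≡0 k)) 0#-homo)) (zeroˡ _)

  lin^-+ : ∀ y n N → lin^ y (+ n ℤ.+ N) P.≈ lin y PE.^ n ⊛ lin^ y N
  lin^-+ y zero    N = P.trans (λ k → *-congʳ (⟨⟩-cong (≡.cong (λ M → binom M k) (ℤ.+-identityˡ N))))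
                               (P.sym (P.*-identityˡ (lin^ y N)))
  lin^-+ y (suc n) N =
    P.trans (λ k → *-congʳ (⟨⟩-cong (≡.cong (λ M → binom M k) (eq (+ n) N))))
   (P.trans (lin^-suc y (+ n ℤ.+ N))
   (P.trans (P.*-congˡ {x = lin y} (lin^-+ y n N))
            (P.sym (P.*-assoc (lin y) (lin y PE.^ n) (lin^ y N)))))
    where
    eq : ∀ n N → + 1 ℤ.+ n ℤ.+ N ≡ + 1 ℤ.+ (n ℤ.+ N)
    eq = solve-∀

  lin^-inverse : ∀ y → lin y ⊛ lin^ y -[1+ 0 ] P.≈ P.1#
  lin^-inverse y = P.trans (P.sym (lin^-suc y -[1+ 0 ])) (lin^-0 y)

  lin^-ℕ : ∀ y n → lin^ y (+ n) P.≈ lin y PE.^ n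
  lin^-ℕ y zero    = lin^-0 y
  lin^-ℕ y (suc n) = P.trans (lin^-suc y (+ n)) (P.*-congˡ {x = lin y} (lin^-ℕ y n))

  -- Narayana polynomials as coefficients of powers of ψ.

  α β ψ ψ⁻¹ : Series
  α = lin 1#
  β = lin q
  ψ = α ⊛ β
  ψ⁻¹ = lin^ 1# -[1+ 0 ] ⊛ lin^ q -[1+ 0 ]

  ⊛-interchange : ∀ a b c d → (a ⊛ b) ⊛ (c ⊛ d) P.≈ (a ⊛ c) ⊛ (b ⊛ d)
  ⊛-interchange = CommutativeSemigroupProperties.interchange P.*-commutativeSemigroup

  ψ⁻¹⊛ψ : ψ⁻¹ ⊛ ψ P.≈ P.1#
  ψ⁻¹⊛ψ = P.trans (P.*-comm ψ⁻¹ ψ)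
         (P.trans (⊛-interchange α β (lin^ 1# -[1+ 0 ]) (lin^ q -[1+ 0 ]))
         (P.trans (⊛-cong (lin^-inverse 1#) (lin^-inverse q)) (P.*-identityˡ P.1#)))

  ψ^ : ∀ n → ψ PE.^ n P.≈ α PE.^ n ⊛ β PE.^ n
  ψ^ = CommutativeSemiringExp.^-distrib-* P.commutativeSemiring α β

  -- The summation index is one lower than in `narayana`, so the exponent of q is the index itself.
  narayanaValue : ℕ → Carrier
  narayanaValue zero      = 1#
  narayanaValue n@(suc _) =
    sum< n λ k → ⟨ (+ 1 ℚ./ n) ℚ.* binom (+ n) k ℚ.* binom (+ n) (suc k) ⟩ * q ^ k

  1^n≈1 : ∀ n → 1# ^ n ≈ 1#
  1^n≈1 zero    = refl
  1^n≈1 (suc n) = trans (*-identityˡ _) (1^n≈1 n)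

  lin^-1 : ∀ N k → lin^ 1# N k ≈ ⟨ binom N k ⟩
  lin^-1 N k = trans (*-congˡ (1^n≈1 k)) (*-identityʳ _)

  -- Once the factor 1/(n+1) is cancelled, reflecting one binomial coefficient by symmetry turns the
  -- sum into the Cauchy product of (1 + q s)^(n+1) and (1 + s)^(n+1) in degree n. This supplies
  -- `C-coeff` for Lagrange inversion.
  narayana-coeff : ∀ n → suc n × narayanaValue (suc n) ≈ (ψ PE.^ suc n) n
  narayana-coeff n = begin
    suc n × narayanaValue (suc n)
      ≈⟨ SemiringMult.×-congʳ semiring (suc n) (trans (sum<-cong (suc n) factor) (sym (*-sum< (suc n) _ term))) ⟩
    suc n × (⟨ + 1 ℚ./ suc n ⟩ * sum< (suc n) term)
      ≈⟨ ×-/ n _ ⟩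
    sum< (suc n) term
      -- The bound on k matters: `n ∸ k` and `suc k` add up to `suc n` only for k ≤ n.
      ≈⟨ sum<-cong-< (suc n) reflect ⟩
    sum< (suc n) (λ k → lin^ q (+ suc n) k * lin^ 1# (+ suc n) (n ℕ.∸ k))
      ≈⟨ ⊛-coeff (lin^ q (+ suc n)) (lin^ 1# (+ suc n)) n ⟨
    (lin^ q (+ suc n) ⊛ lin^ 1# (+ suc n)) n
      ≈⟨ P.*-comm (lin^ q (+ suc n)) (lin^ 1# (+ suc n)) n ⟩
    (lin^ 1# (+ suc n) ⊛ lin^ q (+ suc n)) n
      ≈⟨ ⊛-cong (lin^-ℕ 1# (suc n)) (lin^-ℕ q (suc n)) n ⟩
    (α PE.^ suc n ⊛ β PE.^ suc n) n
      ≈⟨ ψ^ (suc n) n ⟨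
    (ψ PE.^ suc n) n ∎
    where
    term : ℕ → Carrier
    term k = lin^ q (+ suc n) k * ⟨ binom (+ suc n) (suc k) ⟩

    factor : ∀ k →
      ⟨ (+ 1 ℚ./ suc n) ℚ.* binom (+ suc n) k ℚ.* binom (+ suc n) (suc k) ⟩ * q ^ k ≈
      ⟨ + 1 ℚ./ suc n ⟩ * term k
    factor k = trans
      (*-congʳ (trans (*-homo ((+ 1 ℚ./ suc n) ℚ.* binom (+ suc n) k) (binom (+ suc n) (suc k)))
                      (*-congʳ (*-homo (+ 1 ℚ./ suc n) (binom (+ suc n) k)))))
      (solve 4 (λ a b c d → a :* b :* c :* d := a :* (b :* d :* c)) refl _ _ _ _)

    reflect : ∀ k → k ℕ.< suc n →
      term k ≈ lin^ q (+ suc n) k * lin^ 1# (+ suc n) (n ℕ.∸ k)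
    reflect k (s≤s k≤n) = *-congˡ (trans
      (⟨⟩-cong (≡.subst (λ m → binom (+ m) (suc k) ≡ binom (+ m) (n ℕ.∸ k)) n-k+k
                 (≡.sym (binom-sym (n ℕ.∸ k) (suc k)))))
      (sym (lin^-1 (+ suc n) (n ℕ.∸ k))))
      where
      n-k+k : n ℕ.∸ k ℕ.+ suc k ≡ suc n
      n-k+k = ≡.trans (ℕ.+-suc (n ℕ.∸ k) k) (≡.cong suc (ℕ.m∸n+n≡m k≤n))

  -- Binomial sums as coefficients of products of linear powers.

  binomialSum : ℕ → (ℕ → Carrier) → Carrier
  binomialSum b g = sum< (suc b) λ m → ⟨ binom (+ b) m ⟩ * g m

  -- With E the shift of sequences, `binomialSum b g` is the value at 0 of (1 + E)^b g, and this is
  -- (1 + E)^(b+1) = (1 + E)^b + (1 + E)^b E.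
  binomialSum-suc : ∀ b g → binomialSum (suc b) g ≈ binomialSum b g + binomialSum b (g ∘ suc)
  binomialSum-suc b g = begin
    ⟨ 1ℚ ⟩ * g 0 + sum< (suc b) (λ m → ⟨ binom (+ suc b) (suc m) ⟩ * g (suc m))
      ≈⟨ +-congˡ (trans (sum<-cong (suc b) split) (sum<-+ (suc b)
                 (λ m → ⟨ binom (+ b) (suc m) ⟩ * g (suc m)) (λ m → ⟨ binom (+ b) m ⟩ * g (suc m)))) ⟩
    ⟨ 1ℚ ⟩ * g 0 + (sum< (suc b) (λ m → ⟨ binom (+ b) (suc m) ⟩ * g (suc m)) + binomialSum b (g ∘ suc))
      ≈⟨ +-assoc _ _ _ ⟨
    sum< (suc (suc b)) (λ m → ⟨ binom (+ b) m ⟩ * g m) + binomialSum b (g ∘ suc)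
      -- The sum has one term more than `binomialSum b g`, namely the one containing binom(b, b+1) =
      -- 0.
      ≈⟨ +-congʳ (trans (sum<-last (suc b) (λ m → ⟨ binom (+ b) m ⟩ * g m)) (trans (+-congˡ vanish) (+-identityʳ _))) ⟩
    binomialSum b g + binomialSum b (g ∘ suc) ∎
    where
    split : ∀ m → ⟨ binom (+ suc b) (suc m) ⟩ * g (suc m) ≈
                  ⟨ binom (+ b) (suc m) ⟩ * g (suc m) + ⟨ binom (+ b) m ⟩ * g (suc m)
    split m = trans (*-congʳ (trans (⟨⟩-cong (pascal (+ b) m)) (+-homo (binom (+ b) (suc m)) (binom (+ b) m))))
                    (distribʳ _ _ _)

    vanish : ⟨ binom (+ b) (suc b) ⟩ * g (suc b) ≈ 0#
    vanish = trans (*-congʳ (trans (⟨⟩-cong (binom[n,1+n]≡0 b)) 0#-homo)) (zeroˡ _)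

  shiftedTerm : ℤ → ℕ → ℕ → Carrier
  shiftedTerm x k m = ⟨ binom (x ℤ.- + m) k ⟩ * ε ^ m

  -- The common form of the two sums over m in the theorem: b = k - 1, x = n - 2r + 2k on the left,
  -- and b = k = r - 1, x = n on the right.
  shiftedSum : ℕ → ℤ → ℕ → Carrier
  shiftedSum b x k = binomialSum b (shiftedTerm x k)

  -- Shifting the index m by one in `shiftedTerm` produces a factor ε and replaces x by x - 1.
  shiftedSum-suc : ∀ b x k → shiftedSum (suc b) x k ≈ shiftedSum b x k + ε * shiftedSum b (x ℤ.- + 1) k
  shiftedSum-suc b x k = trans (binomialSum-suc b (shiftedTerm x k)) (+-congˡ (begin
    binomialSum b (shiftedTerm x k ∘ suc)
      ≈⟨ sum<-cong (suc b) step ⟩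
    sum< (suc b) (λ m → ε * (⟨ binom (+ b) m ⟩ * shiftedTerm (x ℤ.- + 1) k m))
      ≈⟨ *-sum< (suc b) ε (λ m → ⟨ binom (+ b) m ⟩ * shiftedTerm (x ℤ.- + 1) k m) ⟨
    ε * shiftedSum b (x ℤ.- + 1) k ∎))
    where
    eq : ∀ x m → x ℤ.- (+ 1 ℤ.+ m) ≡ x ℤ.- + 1 ℤ.- m
    eq = solve-∀
    step : ∀ m → ⟨ binom (+ b) m ⟩ * (⟨ binom (x ℤ.- + suc m) k ⟩ * (ε * ε ^ m)) ≈
                 ε * (⟨ binom (+ b) m ⟩ * (⟨ binom (x ℤ.- + 1 ℤ.- + m) k ⟩ * ε ^ m))
    step m = trans (*-congˡ (*-congʳ (⟨⟩-cong (≡.cong (λ y → binom y k) (eq x (+ m))))))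
                   (solve 4 (λ a b e f → a :* (b :* (e :* f)) := e :* (a :* (b :* f))) refl _ _ _ _)

  -- Expresses (1 + q s) + (q - 1) = q (1 + s), the one place in this module where `1+ε≈q` enters.
  lin-q+ε : ∀ f k → (lin q ⊛ f) k + ε * f k ≈ q * (lin 1# ⊛ f) k
  lin-q+ε f zero = begin
    1# * f 0 + ε * f 0    ≈⟨ distribʳ _ _ _ ⟨
    (1# + ε) * f 0        ≈⟨ *-cong 1+ε≈q (sym (*-identityˡ _)) ⟩
    q * (1# * f 0)        ∎
  lin-q+ε f (suc k) = begin
    (lin q ⊛ f) (suc k) + ε * f (suc k)
      ≈⟨ +-congʳ (trans (lin-⊛-suc q f k) (+-congʳ (sym (*-identityˡ _)))) ⟩
    1# * f (suc k) + q * f k + ε * f (suc k)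
      ≈⟨ solve 5 (λ o e q x y → o :* x :+ q :* y :+ e :* x := (o :+ e) :* x :+ q :* y) refl _ _ _ _ _ ⟩
    (1# + ε) * f (suc k) + q * f k
      ≈⟨ +-cong (*-congʳ 1+ε≈q) (*-congˡ (sym (*-identityˡ _))) ⟩
    q * f (suc k) + q * (1# * f k)
      ≈⟨ distribˡ _ _ _ ⟨
    q * (f (suc k) + 1# * f k)
      ≈⟨ *-congˡ (lin-⊛-suc 1# f k) ⟨
    q * (lin 1# ⊛ f) (suc k) ∎

  -- Induction on b for all x at once, since `shiftedSum-suc` calls the sum at x and at x - 1. The
  -- factor q^k on the left turns binom(x - b, k) into a coefficient of (1 + q s)^(x-b).
  shiftedSum-coeff : ∀ b x k →
    q ^ k * shiftedSum b x k ≈ q ^ b * (lin^ q (x ℤ.- + b) ⊛ α PE.^ b) k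
  shiftedSum-coeff zero x k = begin
    q ^ k * (⟨ 1ℚ ⟩ * (⟨ binom (x ℤ.- + 0) k ⟩ * 1#) + 0#)
      ≈⟨ *-congˡ (trans (+-identityʳ _) (trans (*-cong 1#-homo (*-identityʳ _)) (*-identityˡ _))) ⟩
    q ^ k * ⟨ binom (x ℤ.- + 0) k ⟩
      ≈⟨ *-comm _ _ ⟩
    lin^ q (x ℤ.- + 0) k
      ≈⟨ P.*-identityʳ (lin^ q (x ℤ.- + 0)) k ⟨
    (lin^ q (x ℤ.- + 0) ⊛ P.1#) k
      ≈⟨ *-identityˡ _ ⟨
    1# * (lin^ q (x ℤ.- + 0) ⊛ P.1#) k ∎
  shiftedSum-coeff (suc b) x k = begin
    q ^ k * shiftedSum (suc b) x k
      ≈⟨ *-congˡ (shiftedSum-suc b x k) ⟩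
    q ^ k * (shiftedSum b x k + ε * shiftedSum b (x ℤ.- + 1) k)
      ≈⟨ trans (distribˡ _ _ _) (+-congˡ (x∙yz≈y∙xz _ _ _)) ⟩
    q ^ k * shiftedSum b x k + ε * (q ^ k * shiftedSum b (x ℤ.- + 1) k)
      ≈⟨ +-cong (shiftedSum-coeff b x k) (*-congˡ (shiftedSum-coeff b (x ℤ.- + 1) k)) ⟩
    q ^ b * (lin^ q (x ℤ.- + b) ⊛ α PE.^ b) k
      + ε * (q ^ b * (lin^ q (x ℤ.- + 1 ℤ.- + b) ⊛ α PE.^ b) k)
      ≈⟨ +-cong (*-congˡ raise) (*-congˡ (*-congˡ lower)) ⟩
    q ^ b * (β ⊛ W) k + ε * (q ^ b * W k)
      ≈⟨ trans (+-congˡ (x∙yz≈y∙xz _ _ _)) (sym (distribˡ _ _ _)) ⟩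
    q ^ b * ((β ⊛ W) k + ε * W k)
      ≈⟨ *-congˡ (lin-q+ε W k) ⟩
    q ^ b * (q * (α ⊛ W) k)
      ≈⟨ trans (x∙yz≈y∙xz _ _ _) (sym (*-assoc _ _ _)) ⟩
    q ^ suc b * (α ⊛ W) k
      ≈⟨ *-congˡ (P-x∙yz≈y∙xz α (lin^ q (x ℤ.- + suc b)) (α PE.^ b) k) ⟩
    q ^ suc b * (lin^ q (x ℤ.- + suc b) ⊛ α PE.^ suc b) k ∎
    where
    open CommutativeSemigroupProperties P.*-commutativeSemigroup
      using () renaming (x∙yz≈y∙xz to P-x∙yz≈y∙xz)

    -- The common factor of the two hypotheses: the one at x gives β W and the one at x - 1 gives W,
    -- so together they yield (β + ε) W = q α W.
    W : Series
    W = lin^ q (x ℤ.- + suc b) ⊛ α PE.^ b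

    eq₁ : ∀ x b → x ℤ.- b ≡ + 1 ℤ.+ (x ℤ.- (+ 1 ℤ.+ b))
    eq₁ = solve-∀
    eq₂ : ∀ x b → x ℤ.- + 1 ℤ.- b ≡ x ℤ.- (+ 1 ℤ.+ b)
    eq₂ = solve-∀

    raise : (lin^ q (x ℤ.- + b) ⊛ α PE.^ b) k ≈ (β ⊛ W) k
    raise = trans (reflexive (≡.cong (λ N → (lin^ q N ⊛ α PE.^ b) k) (eq₁ x (+ b))))
           (trans (P.*-congʳ {x = α PE.^ b} (lin^-suc q (x ℤ.- + suc b)) k)
                  (P.*-assoc β (lin^ q (x ℤ.- + suc b)) (α PE.^ b) k))

    lower : (lin^ q (x ℤ.- + 1 ℤ.- + b) ⊛ α PE.^ b) k ≈ W k
    lower = reflexive (≡.cong (λ N → (lin^ q N ⊛ α PE.^ b) k) (eq₂ x (+ b)))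

  -- The specialisation of Lagrange inversion.

  q^-cancel : ∀ n {x y} → q ^ n * x ≈ q ^ n * y → x ≈ y
  q^-cancel zero    eq = trans (sym (*-identityˡ _)) (trans eq (*-identityˡ _))
  q^-cancel (suc n) eq = q^-cancel n (q-cancel (trans (sym (*-assoc _ _ _)) (trans eq (*-assoc _ _ _))))

  -- Here r and k are each one less than in the theorem. The summand k = 0 of
  -- `convolution (suc r) K` is the isolated Narayana polynomial, because K has constant term 1; the
  -- later summands form the sum.
  identity : ∀ n r →
    narayanaValue (suc r) + q * sum< r (λ k → narayanaValue (r ℕ.∸ k) *
      shiftedSum k (+ n ℤ.- + (2 ℕ.* suc r) ℤ.+ + (2 ℕ.* suc k)) (suc k))
    ≈ shiftedSum r (+ n) r
  identity n r = begin
    narayanaValue (suc r) + q * sum< r (λ k → narayanaValue (r ℕ.∸ k) * A k)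
      ≈⟨ +-cong (trans (*-congˡ K₀) (*-identityʳ _))
                (trans (sum<-cong r (λ k → trans (*-congˡ (inner k)) (x∙yz≈y∙xz _ _ _))) (sym (*-sum< r q _))) ⟨
    convolution (suc r) K
      ≈⟨ inverts (suc r) K ⟩
    (K ⊛ ψ PE.^ suc r) r
      ≈⟨ K⊛ψ^ r r ⟩
    (lin^ q (+ suc r ℤ.+ N) ⊛ α PE.^ r) r
      ≈⟨ reflexive (≡.cong (λ M → (lin^ q M ⊛ α PE.^ r) r) (eq₂ (+ n) (+ r))) ⟩
    (lin^ q (+ n ℤ.- + r) ⊛ α PE.^ r) r
      ≈⟨ q^-cancel r (shiftedSum-coeff r (+ n) r) ⟨
    shiftedSum r (+ n) r ∎
    where
    open Lagrange.Inversion R ×-cancel ψ ψ⁻¹ ψ⁻¹⊛ψ narayanaValue narayana-coeff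
      using (convolution; inverts)

    x : ℕ → ℤ
    x k = + n ℤ.- + (2 ℕ.* suc r) ℤ.+ + (2 ℕ.* suc k)

    A : ℕ → Carrier
    A k = shiftedSum k (x k) (suc k)

    -- Chosen so that K ψ^(k+1) = (1 + q s)^(k+1+N) (1 + s)^k has k + 1 + N = `x k` - k for every k;
    -- at k = r this exponent is n - r, as the right-hand side requires.
    N : ℤ
    N = + n ℤ.- + (2 ℕ.* suc r) ℤ.+ + 1

    K : Series
    K = lin^ 1# -[1+ 0 ] ⊛ lin^ q N

    K₀ : (K ⊛ P.1#) 0 ≈ 1#
    K₀ = trans (*-identityʳ _)
               (trans (*-cong (lin^-zero 1# -[1+ 0 ]) (lin^-zero q N)) (*-identityˡ _))

    -- The terms ending in `+ 0` are the unfolded forms of `+ (2 ℕ.* suc k)` and, below, of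
    -- `+ (2 ℕ.* suc r)`.
    eq₁ : ∀ n R k → n ℤ.- R ℤ.+ (+ 1 ℤ.+ k ℤ.+ (+ 1 ℤ.+ k ℤ.+ + 0)) ℤ.- k ≡
                    + 1 ℤ.+ k ℤ.+ (n ℤ.- R ℤ.+ + 1)
    eq₁ = solve-∀
    eq₂ : ∀ n r → + 1 ℤ.+ r ℤ.+ (n ℤ.- (+ 1 ℤ.+ r ℤ.+ (+ 1 ℤ.+ r ℤ.+ + 0)) ℤ.+ + 1) ≡ n ℤ.- r
    eq₂ = solve-∀

    K⊛ψ^ : ∀ k → K ⊛ ψ PE.^ suc k P.≈ lin^ q (+ suc k ℤ.+ N) ⊛ α PE.^ k
    K⊛ψ^ k =
      P.trans (P.*-congˡ {x = K} (ψ^ (suc k)))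
     (P.trans (⊛-interchange α⁻¹ (lin^ q N) (α PE.^ suc k) (β PE.^ suc k))
     (P.trans (⊛-cong α-part (P.trans (P.*-comm (lin^ q N) (β PE.^ suc k)) (P.sym (lin^-+ q (suc k) N))))
              (P.*-comm (α PE.^ k) (lin^ q (+ suc k ℤ.+ N)))))
      where
      α⁻¹ : Series
      α⁻¹ = lin^ 1# -[1+ 0 ]

      α-part : α⁻¹ ⊛ α PE.^ suc k P.≈ α PE.^ k
      α-part = P.trans (P.sym (P.*-assoc α⁻¹ α (α PE.^ k)))
              (P.trans (P.*-congʳ {x = α PE.^ k} (P.trans (P.*-comm α⁻¹ α) (lin^-inverse 1#)))
                       (P.*-identityˡ (α PE.^ k)))

    -- In `shiftedSum-coeff` with b = k and degree k + 1 the powers of q differ by one. The surplus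
    -- q is the factor in front of the sum in the theorem.
    inner : ∀ k → (K ⊛ ψ PE.^ suc k) (suc k) ≈ q * A k
    inner k = q^-cancel k (begin
      q ^ k * (K ⊛ ψ PE.^ suc k) (suc k)
        ≈⟨ *-congˡ (K⊛ψ^ k (suc k)) ⟩
      q ^ k * (lin^ q (+ suc k ℤ.+ N) ⊛ α PE.^ k) (suc k)
        ≈⟨ *-congˡ (reflexive (≡.cong (λ M → (lin^ q M ⊛ α PE.^ k) (suc k)) (eq₁ (+ n) (+ (2 ℕ.* suc r)) (+ k)))) ⟨
      q ^ k * (lin^ q (x k ℤ.- + k) ⊛ α PE.^ k) (suc k)
        ≈⟨ shiftedSum-coeff k (x k) (suc k) ⟨
      q ^ suc k * A k
        ≈⟨ trans (*-assoc _ _ _) (x∙yz≈y∙xz _ _ _) ⟩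
      q ^ k * (q * A k) ∎)

-- Transfer from coefficient lists to the ring ℚ[[q]].

module Coefficients where
  open PowerSeries ℚ.+-*-commutativeRing
  open CommutativeRing series hiding (zero)
  open RangeSum series
  open SemiringExp semiring using (_^_)

  const-isHomomorphism :
    SemiringMorphisms.IsSemiringHomomorphism ℚ.+-*-rawSemiring (Semiring.rawSemiring semiring) const
  const-isHomomorphism = record
    { isNearSemiringHomomorphism = record
      { +-isMonoidHomomorphism = record
        { isMagmaHomomorphism = record
          { isRelHomomorphism = record { cong = λ { ≡.refl _ → ≡.refl } }
          ; homo = λ { x y zero → ≡.refl ; x y (suc n) → ≡.refl }
          }
        ; ε-homo = λ { zero → ≡.refl ; (suc n) → ≡.refl }
        }
      ; *-homo = λ { x y zero → ≡.refl
                   ; x y (suc n) → ≡.sym (≡.trans (const-⊛ x (const y) (suc n)) (ℚ.*-zeroʳ x)) }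
      }
    ; 1#-homo = λ _ → ≡.refl
    }

  coeff-constₚ : ∀ x → coeff (constₚ x) ≈ const x
  coeff-constₚ x zero    = ≡.refl
  coeff-constₚ x (suc n) = ≡.refl

  coeff-+ : ∀ p r → coeff (p +ₚ r) ≈ coeff p + coeff r
  coeff-+ []      r       n       = ≡.sym (ℚ.+-identityˡ (coeff r n))
  coeff-+ (a ∷ p) []      n       = ≡.sym (ℚ.+-identityʳ (coeff (a ∷ p) n))
  coeff-+ (a ∷ p) (b ∷ r) zero    = ≡.refl
  coeff-+ (a ∷ p) (b ∷ r) (suc n) = coeff-+ p r n

  coeff-·-pointwise : ∀ x p n → coeff (x ·ₚ p) n ≡ x ℚ.* coeff p n
  coeff-·-pointwise x []      n       = ≡.sym (ℚ.*-zeroʳ x)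
  coeff-·-pointwise x (a ∷ p) zero    = ≡.refl
  coeff-·-pointwise x (a ∷ p) (suc n) = coeff-·-pointwise x p n

  coeff-· : ∀ x p → coeff (x ·ₚ p) ≈ const x * coeff p
  coeff-· x p n = ≡.trans (coeff-·-pointwise x p n) (≡.sym (const-⊛ x (coeff p) n))

  coeff-* : ∀ p r → coeff (p *ₚ r) ≈ coeff p * coeff r
  coeff-* []      r n       = ≡.sym (⊛-zeroˡ (coeff r) n)
  coeff-* (a ∷ p) r zero    = ≡.trans (coeff-+ (a ·ₚ r) (0ℚ ∷ (p *ₚ r)) zero)
    (≡.trans (ℚ.+-identityʳ (coeff (a ·ₚ r) 0)) (coeff-·-pointwise a r 0))
  coeff-* (a ∷ p) r (suc n) = ≡.trans (coeff-+ (a ·ₚ r) (0ℚ ∷ (p *ₚ r)) (suc n))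
    (≡.cong₂ ℚ._+_ (coeff-·-pointwise a r (suc n)) (coeff-* p r n))

  coeff-^ : ∀ p n → coeff (p ^ₚ n) ≈ coeff p ^ n
  coeff-^ p zero    = coeff-constₚ 1ℚ
  coeff-^ p (suc n) = trans (coeff-* p (p ^ₚ n)) (*-congˡ {x = coeff p} (coeff-^ p n))

  -- The loop inside `sumFromTo` recurses on the number of terms. Naming that number `c` lets the
  -- induction follow the loop; after one step, the loop started at a continues as the loop started
  -- at a + 1.
  coeff-sumFromTo : ∀ c a b f → suc b ℕ.∸ a ≡ c →
                    coeff (sumFromTo a b f) ≈ sum< c (λ i → coeff (f (a ℕ.+ i)))
  coeff-sumFromTo zero    a b f eq n rewrite eq = ≡.refl
  coeff-sumFromTo (suc c) a b f eq = trans split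
    (+-cong (reflexive (≡.cong (coeff ∘ f) (≡.sym (ℕ.+-identityʳ a))))
      (trans (coeff-sumFromTo c (suc a) b f eq′)
        (sum<-cong c λ i → reflexive (≡.cong (coeff ∘ f) (≡.sym (ℕ.+-suc a i))))))
    where
    eq′ : suc b ℕ.∸ suc a ≡ c
    eq′ = ≡.trans (≡.sym (ℕ.pred[m∸n]≡m∸[1+n] (suc b) a)) (≡.cong ℕ.pred eq)

    split : coeff (sumFromTo a b f) ≈ coeff (f a) + coeff (sumFromTo (suc a) b f)
    split rewrite eq | eq′ = coeff-+ (f a) _

  coeff-sum₀ : ∀ b f → coeff (sumFromTo 0 b f) ≈ sum< (suc b) (coeff ∘ f)
  coeff-sum₀ b f = coeff-sumFromTo (suc b) 0 b f ≡.refl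

  coeff-sum₁ : ∀ b f → coeff (sumFromTo 1 b f) ≈ sum< b (coeff ∘ f ∘ suc)
  coeff-sum₁ b f = coeff-sumFromTo b 1 b f ≡.refl

  q : Series
  q = coeff qₚ

  ε : Series
  ε = coeff q-1ₚ

  1+ε≈q : 1# + ε ≈ q
  1+ε≈q zero          = ≡.refl
  1+ε≈q (suc zero)    = ≡.refl
  1+ε≈q (suc (suc n)) = ≡.refl

  q-⊛-suc : ∀ f n → (q ⊛ f) (suc n) ≡ f n
  q-⊛-suc f n = ≡.trans (≡.cong₂ ℚ._+_ (ℚ.*-zeroˡ (f (suc n))) (shifted n)) (ℚ.+-identityˡ (f n))
    where
    shifted : coeff 1ₚ ⊛ f ≈ f
    shifted = trans (*-congʳ {x = f} (coeff-constₚ 1ℚ)) (*-identityˡ f)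

  -- Multiplication by q shifts coefficients up by one, so each coefficient of f is read off from q
  -- f one degree higher.
  q-cancel : ∀ {f g} → q * f ≈ q * g → f ≈ g
  q-cancel {f} {g} eq n = ≡.trans (≡.sym (q-⊛-suc f n)) (≡.trans (eq (suc n)) (q-⊛-suc g n))

  pointedℚAlgebra : PointedℚAlgebra series
  pointedℚAlgebra = record
    { ⟨_⟩ = const
    ; ⟨⟩-isHomomorphism = const-isHomomorphism
    ; q = q
    ; ε = ε
    ; 1+ε≈q = 1+ε≈q
    ; q-cancel = λ {f} {g} → q-cancel {f} {g}
    }

  open NarayanaIdentity series pointedℚAlgebra
    using (narayanaValue; shiftedSum; identity) public

  coeff-narayana : ∀ n → coeff (narayana n) ≈ narayanaValue n
  coeff-narayana zero      = coeff-constₚ 1ℚ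
  coeff-narayana n@(suc _) = trans (coeff-sum₁ n term) (sum<-cong n λ k →
    trans (coeff-· (number (suc k)) (qₚ ^ₚ k)) (*-congˡ {x = const (number (suc k))} (coeff-^ qₚ k)))
    where
    number : ℕ → ℚ
    number k = (+ 1 ℚ./ n) ℚ.* binom (+ n) (k ℕ.∸ 1) ℚ.* binom (+ n) k

    term : ℕ → Poly
    term k = number k ·ₚ (qₚ ^ₚ (k ℕ.∸ 1))

  -- Spelled term by term like the sums over m in the theorem, so that those sums become instances
  -- of it by computation alone.
  shiftedPoly : ℕ → ℤ → ℕ → Poly
  shiftedPoly b x k = sumFromTo 0 b λ m →
    binom (+ b) m ·ₚ (binom (x ℤ.- + m) k ·ₚ (q-1ₚ ^ₚ m))

  coeff-shiftedPoly : ∀ b x k → coeff (shiftedPoly b x k) ≈ shiftedSum b x k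
  coeff-shiftedPoly b x k = trans (coeff-sum₀ b (λ m → binom (+ b) m ·ₚ inner m)) (sum<-cong (suc b) λ m →
    trans (coeff-· (binom (+ b) m) (inner m)) (*-congˡ {x = const (binom (+ b) m)}
      (trans (coeff-· (binom (x ℤ.- + m) k) (q-1ₚ ^ₚ m)) (*-congˡ {x = const (binom (x ℤ.- + m) k)}
        (coeff-^ q-1ₚ m)))))
    where
    inner : ℕ → Poly
    inner m = binom (x ℤ.- + m) k ·ₚ (q-1ₚ ^ₚ m)

-- The identity for polynomials.

theorem4 : (n r : ℕ) → 1 ℕ.≤ n → 1 ℕ.≤ r →
    narayana r +ₚ qₚ *ₚ sumFromTo 1 (r ℕ.∸ 1) (λ k →
    narayana (r ℕ.∸ k) *ₚ sumFromTo 0 (k ℕ.∸ 1) (λ m →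
    binom (+ (k ℕ.∸ 1)) m ·ₚ (binom (+ n ℤ.- + (2 ℕ.* r) ℤ.+ + (2 ℕ.* k) ℤ.- + m) k ·ₚ (q-1ₚ ^ₚ m))))
    ≈ₚ sumFromTo 0 (r ℕ.∸ 1) (λ m →
    binom (+ (r ℕ.∸ 1)) m ·ₚ (binom (+ n ℤ.- + m) (r ℕ.∸ 1) ·ₚ (q-1ₚ ^ₚ m)))
theorem4 n (suc r) _ _ = begin
  -- `_≈ₚ_` is equality of the coefficient series, so the chain runs in ℚ[[q]]. With `suc r` for the
  -- theorem's r, the subtraction `r ∸ 1` computes away.
  coeff (narayana (suc r) +ₚ qₚ *ₚ sumFromTo 1 r summand)
    ≈⟨ coeff-+ (narayana (suc r)) (qₚ *ₚ sumFromTo 1 r summand) ⟩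
  coeff (narayana (suc r)) + coeff (qₚ *ₚ sumFromTo 1 r summand)
    ≈⟨ +-cong {x = coeff (narayana (suc r))} (coeff-narayana (suc r)) rest ⟩
  narayanaValue (suc r) + q * sum< r (λ k → narayanaValue (r ℕ.∸ k) * shiftedSum k (x k) (suc k))
    ≈⟨ identity n r ⟩
  shiftedSum r (+ n) r
    ≈⟨ coeff-shiftedPoly r (+ n) r ⟨
  coeff (shiftedPoly r (+ n) r) ∎
  where
  open Coefficients
  open CommutativeRing (PowerSeries.series ℚ.+-*-commutativeRing) hiding (zero)
  open RangeSum (PowerSeries.series ℚ.+-*-commutativeRing)
  open SetoidReasoning setoid

  x : ℕ → ℤ
  x k = + n ℤ.- + (2 ℕ.* suc r) ℤ.+ + (2 ℕ.* suc k)

  summand : ℕ → Poly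
  summand k = narayana (suc r ℕ.∸ k) *ₚ sumFromTo 0 (k ℕ.∸ 1) (λ m →
    binom (+ (k ℕ.∸ 1)) m ·ₚ (binom (+ n ℤ.- + (2 ℕ.* suc r) ℤ.+ + (2 ℕ.* k) ℤ.- + m) k ·ₚ (q-1ₚ ^ₚ m)))

  rest : coeff (qₚ *ₚ sumFromTo 1 r summand) ≈
         q * sum< r (λ k → narayanaValue (r ℕ.∸ k) * shiftedSum k (x k) (suc k))
  rest = trans (coeff-* qₚ (sumFromTo 1 r summand)) (*-congˡ {x = q}
    -- `coeff-sum₁` evaluates `summand` at `suc k`; there `k ∸ 1` computes away and the inner sum is
    -- `shiftedPoly k (x k) (suc k)`.
    (trans (coeff-sum₁ r summand) (sum<-cong r λ k →
      trans (coeff-* (narayana (r ℕ.∸ k)) (shiftedPoly k (x k) (suc k)))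
            (*-cong (coeff-narayana (r ℕ.∸ k)) (coeff-shiftedPoly k (x k) (suc k))))))
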